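{- The greedy algorithm for NANIP with convex cost functions has worst-case approximation ratio $\Omega(n)$: there exist a convex cost function $f$, a constant $c>0$, and connected graphs $G$ with arbitrarily large number $n$ of vertices such that, for some way of breaking ties, the greedy algorithm outputs a permutation $\sigma$ with $C_G(\sigma)\ge c\, n\cdot \min_\tau C_G(\tau)$, where the minimum is over all permutations $\tau$ of the vertices of $G$.
   Context: An instance of NANIP consists of a finite undirected graph $G=(V,E)$ with $n=|V|$ vertices and a cost function $f:\mathbb{N}\to\mathbb{R}_{\ge 0}$. For a permutation $\sigma=(v_1,\dots,v_n)$ of $V$, $r(v_t,G,\sigma)$ is the number of neighbors of $v_t$ in $G$ appearing before $v_t$ in $\sigma$, and $C_G(\sigma)=\sum_{t=1}^n f(r(v_t,G,\sigma))$. The function $f$ is convex if $f(i+2)-f(i+1)\ge f(i+1)-f(i)$ for all $i$. The greedy algorithm builds the permutation one vertex at a time, at each step choosing, among the not-yet-chosen vertices, one whose cost $f(\text{number of already chosen neighbors})$ is minimal, breaking ties arbitrarily. -}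

module Defs where

open import Data.Nat as ℕ using (ℕ; zero; suc)
open import Data.Fin using (Fin; toℕ; inject₁; fromℕ)
open import Data.Bool using (Bool; true; false; if_then_else_)
open import Data.Product using (Σ; ∃; _×_; _,_)
open import Data.Integer using (+_)
open import Data.Rational using (ℚ; 0ℚ; _+_; _-_; _*_; _≤_; _<_; _/_)
open import Function.Definitions using (Injective)
open import Relation.Binary.PropositionalEquality using (_≡_; _≢_)
open import Relation.Nullary using (¬_)

record Graph (n : ℕ) : Set where
  field
    adj     : Fin n → Fin n → Bool
    symm    : ∀ u v → adj u v ≡ adj v u
    irrefl  : ∀ v → adj v v ≡ false
open Graph public

data Reachable {n : ℕ} (G : Graph n) (u : Fin n) : Fin n → Set where
  here : Reachable G u u
  step : ∀ {v w} → Reachable G u v → adj G v w ≡ true → Reachable G u w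

Connected : {n : ℕ} → Graph n → Set
Connected {n} G = ∀ (u v : Fin n) → Reachable G u v

-- A permutation σ = (v_0, …, v_{n-1}) of the vertices: σ t is the vertex at
-- position t; σ is injective (hence bijective, Fin n being finite).
IsPerm : {n : ℕ} → (Fin n → Fin n) → Set
IsPerm σ = Injective _≡_ _≡_ σ

countBelow : ℕ → (ℕ → Bool) → ℕ
countBelow zero    P = zero
countBelow (suc k) P = (if P k then 1 else 0) ℕ.+ countBelow k P

-- Extend a function on Fin n to ℕ (values outside range irrelevant here).
atℕ : {n : ℕ} {A : Set} → (Fin n → A) → A → ℕ → A
atℕ {zero}  σ d k       = d
atℕ {suc n} σ d zero    = σ Data.Fin.zero
atℕ {suc n} σ d (suc k) = atℕ {n} (λ i → σ (Data.Fin.suc i)) d k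

nbrsBefore : {n : ℕ} → Graph n → (Fin n → Fin n) → ℕ → Fin n → ℕ
nbrsBefore G σ k u = countBelow k (λ s → atℕ (λ i → adj G (σ i) u) false s)

rank : {n : ℕ} → Graph n → (Fin n → Fin n) → Fin n → ℕ
rank G σ t = nbrsBefore G σ (toℕ t) (σ t)

sumFin : {n : ℕ} → (Fin n → ℚ) → ℚ
sumFin {zero}  g = 0ℚ
sumFin {suc n} g = g Data.Fin.zero + sumFin (λ i → g (Data.Fin.suc i))

cost : {n : ℕ} → Graph n → (ℕ → ℚ) → (Fin n → Fin n) → ℚ
cost G f σ = sumFin (λ t → f (rank G σ t))

Convex : (ℕ → ℚ) → Set
Convex f = ∀ i → f (suc i) - f i ≤ f (suc (suc i)) - f (suc i)

NonNeg : (ℕ → ℚ) → Set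
NonNeg f = ∀ i → 0ℚ ≤ f i

-- σ is a possible output of the greedy algorithm (for some tie-breaking):
-- at every step t, the chosen vertex σ t minimises f(#already-chosen
-- neighbours) among all vertices not yet chosen.
IsGreedy : {n : ℕ} → Graph n → (ℕ → ℚ) → (Fin n → Fin n) → Set
IsGreedy {n} G f σ =
  ∀ (t : Fin n) (u : Fin n) →
    (∀ (s : Fin n) → ℕ._<_ (toℕ s) (toℕ t) → σ s ≢ u) →
    f (nbrsBefore G σ (toℕ t) (σ t)) ≤ f (nbrsBefore G σ (toℕ t) u)

IsMinCost : {n : ℕ} → Graph n → (ℕ → ℚ) → ℚ → Set
IsMinCost G f m =
  (∃ λ τ → IsPerm τ × cost G f τ ≡ m) × (∀ τ → IsPerm τ → m ≤ cost G f τ)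

ℕtoℚ : ℕ → ℚ
ℕtoℚ n = + n / 1

module Submission where

-- The lower bound is witnessed by stars.  Let S_k be the star with leaves
-- 0, …, k-1 and centre k, and let f = steep, a convex cost with f 0 = f 1 = 1
-- whose values grow quadratically fast.
--   * Since f 0 is the least value of f, placing all leaves first and the
--     centre last is a greedy order: every leaf costs f 0, and the centre is
--     only chosen once nothing else is left.  Its cost is at least f k.
--   * Placing the centre first gives cost f 0 + k · f 1 = k + 1, so the
--     optimum m satisfies m ≤ k + 1; also m > 0 because f ≥ 1.
--   * f k ≥ (k + 1)², hence with c = 1 and n = k + 1 we get n · m ≤ f k.

open import Defs
open import Data.Nat using (ℕ)
open import Data.Fin using (Fin)
open import Data.Product using (Σ; _×_; _,_)
open import Data.Rational using (ℚ; 0ℚ; _*_; _≤_; _<_)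

open import Data.Nat as ℕ using (zero; suc)
import Data.Nat.Properties as ℕP
import Data.Integer as ℤ
import Data.Integer.Properties as ℤP
open import Data.Rational using (1ℚ; _+_; _-_; mkℚ; *≤*; *<*; nonNegative)
import Data.Rational.Properties as ℚP
import Data.Nat.Coprimality as Coprime
open import Data.Fin as Fin using (toℕ; fromℕ; fromℕ<; inject₁; _≟_)
import Data.Fin.Properties as FinP
open import Data.Bool using (Bool; true; false; _xor_; if_then_else_)
open import Data.Bool.Properties using (xor-comm; xor-same)
open import Data.Empty using (⊥-elim)
open import Relation.Nullary using (yes; no; does)
open import Relation.Nullary.Decidable using (dec-true; dec-false)
open import Relation.Binary.PropositionalEquality

ℕtoℚ-mkℚ : ∀ n → ℕtoℚ n ≡ mkℚ (ℤ.+ n) 0 (Coprime.sym (Coprime.1-coprimeTo n))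
ℕtoℚ-mkℚ n = ℚP.normalize-coprime (Coprime.sym (Coprime.1-coprimeTo n))

ℕtoℚ-+ : ∀ a b → ℕtoℚ (a ℕ.+ b) ≡ ℕtoℚ a + ℕtoℚ b
ℕtoℚ-+ a b rewrite ℕtoℚ-mkℚ a | ℕtoℚ-mkℚ b | ℕP.*-identityʳ a | ℕP.*-identityʳ b
                 | ℤP.+◃n≡+n a | ℤP.+◃n≡+n b = refl

ℕtoℚ-* : ∀ a b → ℕtoℚ (a ℕ.* b) ≡ ℕtoℚ a * ℕtoℚ b
ℕtoℚ-* a b rewrite ℕtoℚ-mkℚ a | ℕtoℚ-mkℚ b | ℤP.+◃n≡+n (a ℕ.* b) = refl

ℕtoℚ-mono-≤ : ∀ {a b} → a ℕ.≤ b → ℕtoℚ a ≤ ℕtoℚ b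
ℕtoℚ-mono-≤ {a} {b} a≤b rewrite ℕtoℚ-mkℚ a | ℕtoℚ-mkℚ b =
  *≤* (ℤP.*-monoʳ-≤-nonNeg (ℤ.+ 1) (ℤ.+≤+ a≤b))

ℕtoℚ-mono-< : ∀ {a b} → a ℕ.< b → ℕtoℚ a < ℕtoℚ b
ℕtoℚ-mono-< {a} {b} a<b rewrite ℕtoℚ-mkℚ a | ℕtoℚ-mkℚ b =
  *<* (ℤP.*-monoʳ-<-pos (ℤ.+ 1) (ℤ.+<+ a<b))

sumℕ : ∀ {n} → (Fin n → ℕ) → ℕ
sumℕ {zero}  h = 0
sumℕ {suc n} h = h Fin.zero ℕ.+ sumℕ (λ i → h (Fin.suc i))

sumℕ-≥-term : ∀ {n} (h : Fin n → ℕ) i → h i ℕ.≤ sumℕ h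
sumℕ-≥-term h Fin.zero = ℕP.m≤m+n _ _
sumℕ-≥-term {suc n} h (Fin.suc i) =
  ℕP.≤-trans (sumℕ-≥-term (λ j → h (Fin.suc j)) i) (ℕP.m≤n+m _ (h Fin.zero))

sumℕ-const : ∀ {n} (h : Fin n → ℕ) c → (∀ i → h i ≡ c) → sumℕ h ≡ n ℕ.* c
sumℕ-const {zero}  h c hc = refl
sumℕ-const {suc n} h c hc rewrite hc Fin.zero =
  cong (c ℕ.+_) (sumℕ-const (λ i → h (Fin.suc i)) c (λ i → hc (Fin.suc i)))

sumFin-ℕtoℚ : ∀ {n} (h : Fin n → ℕ) → sumFin (λ t → ℕtoℚ (h t)) ≡ ℕtoℚ (sumℕ h)
sumFin-ℕtoℚ {zero}  h = refl
sumFin-ℕtoℚ {suc n} h = begin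
  ℕtoℚ (h Fin.zero) + sumFin (λ i → ℕtoℚ (h (Fin.suc i)))
    ≡⟨ cong (ℕtoℚ (h Fin.zero) +_) (sumFin-ℕtoℚ (λ i → h (Fin.suc i))) ⟩
  ℕtoℚ (h Fin.zero) + ℕtoℚ (sumℕ (λ i → h (Fin.suc i)))
    ≡⟨ sym (ℕtoℚ-+ (h Fin.zero) _) ⟩
  ℕtoℚ (sumℕ h) ∎
  where open ≡-Reasoning

cost-ℕ : ∀ {n} (G : Graph n) (h : ℕ → ℕ) σ →
         cost G (λ i → ℕtoℚ (h i)) σ ≡ ℕtoℚ (sumℕ (λ t → h (rank G σ t)))
cost-ℕ G h σ = sumFin-ℕtoℚ (λ t → h (rank G σ t))

cost-pos : ∀ {n} (G : Graph (suc n)) (h : ℕ → ℕ) → (∀ i → 1 ℕ.≤ h i) →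
           ∀ σ → 0ℚ < cost G (λ i → ℕtoℚ (h i)) σ
cost-pos G h h≥1 σ = subst (0ℚ <_) (sym (cost-ℕ G h σ))
  (ℕtoℚ-mono-< (ℕP.≤-trans (h≥1 _) (sumℕ-≥-term (λ t → h (rank G σ t)) Fin.zero)))

atℕ-fromℕ< : ∀ {n} {A : Set} (σ : Fin n → A) d s (s<n : s ℕ.< n) →
             atℕ σ d s ≡ σ (fromℕ< s<n)
atℕ-fromℕ< {suc n} σ d zero    s<n = refl
atℕ-fromℕ< {suc n} σ d (suc s) s<n = atℕ-fromℕ< (λ i → σ (Fin.suc i)) d s (ℕ.s≤s⁻¹ s<n)

countBelow-cong : ∀ t P Q → (∀ s → s ℕ.< t → P s ≡ Q s) → countBelow t P ≡ countBelow t Q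
countBelow-cong zero    P Q P≗Q = refl
countBelow-cong (suc t) P Q P≗Q = cong₂ (λ b c → (if b then 1 else 0) ℕ.+ c)
  (P≗Q t (ℕP.n<1+n t)) (countBelow-cong t P Q (λ s s<t → P≗Q s (ℕP.m<n⇒m<1+n s<t)))

countBelow-const : ∀ t b → countBelow t (λ _ → b) ≡ (if b then t else 0)
countBelow-const zero    false = refl
countBelow-const zero    true  = refl
countBelow-const (suc t) false = countBelow-const t false
countBelow-const (suc t) true  = cong suc (countBelow-const t true)

countBelow-only-first : ∀ j P → P 0 ≡ true → (∀ s → s ℕ.< j → P (suc s) ≡ false) →
                        countBelow (suc j) P ≡ 1
countBelow-only-first zero    P P0 rest rewrite P0 = refl
countBelow-only-first (suc j) P P0 rest rewrite rest j (ℕP.n<1+n j) =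
  countBelow-only-first j P P0 (λ s s<j → rest s (ℕP.m<n⇒m<1+n s<j))

increment : ℕ → ℕ
increment i = (i ℕ.+ i) ℕ.* (i ℕ.+ i)

steep : ℕ → ℕ
steep zero    = 1
steep (suc i) = steep i ℕ.+ increment i

steepℚ : ℕ → ℚ
steepℚ i = ℕtoℚ (steep i)

steep-≥1 : ∀ i → 1 ℕ.≤ steep i
steep-≥1 zero    = ℕP.≤-refl
steep-≥1 (suc i) = ℕP.≤-trans (steep-≥1 i) (ℕP.m≤m+n _ _)

steepℚ-nonNeg : NonNeg steepℚ
steepℚ-nonNeg i = ℕtoℚ-mono-≤ {0} {steep i} ℕ.z≤n

-- The value at 0 is the least one, which is what makes greed harmful here.
steepℚ-least-at-0 : ∀ i → steepℚ 0 ≤ steepℚ i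
steepℚ-least-at-0 i = ℕtoℚ-mono-≤ (steep-≥1 i)

steepℚ-convex : Convex steepℚ
steepℚ-convex i =
  subst₂ _≤_ (sym (difference (steep i) (increment i)))
             (sym (difference (steep (suc i)) (increment (suc i))))
             (ℕtoℚ-mono-≤ (ℕP.*-mono-≤ i+i≤ i+i≤))
  where
  i+i≤ : i ℕ.+ i ℕ.≤ suc i ℕ.+ suc i
  i+i≤ = ℕP.+-mono-≤ (ℕP.n≤1+n i) (ℕP.n≤1+n i)

  difference : ∀ a b → ℕtoℚ (a ℕ.+ b) - ℕtoℚ a ≡ ℕtoℚ b
  difference a b rewrite ℕtoℚ-+ a b = begin
    (ℕtoℚ a + ℕtoℚ b) - ℕtoℚ a ≡⟨ cong (_- ℕtoℚ a) (ℚP.+-comm (ℕtoℚ a) (ℕtoℚ b)) ⟩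
    (ℕtoℚ b + ℕtoℚ a) - ℕtoℚ a ≡⟨ ℚP.+-assoc (ℕtoℚ b) (ℕtoℚ a) _ ⟩
    ℕtoℚ b + (ℕtoℚ a - ℕtoℚ a) ≡⟨ cong (ℕtoℚ b +_) (ℚP.+-inverseʳ (ℕtoℚ a)) ⟩
    ℕtoℚ b + 0ℚ                              ≡⟨ ℚP.+-identityʳ (ℕtoℚ b) ⟩
    ℕtoℚ b ∎
    where open ≡-Reasoning

-- For k ≥ 3: (k + 1)(steep 0 + k · steep 1) = (k + 1)² ≤ (2(k-1))² ≤ steep k.
steep-outgrows : ∀ k → 3 ℕ.≤ k → suc k ℕ.* (steep 0 ℕ.+ k ℕ.* steep 1) ℕ.≤ steep k
steep-outgrows (suc j) (ℕ.s≤s 2≤j) =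
  ℕP.≤-trans (subst (λ x → suc (suc j) ℕ.* x ℕ.≤ increment j) k+1≡ (ℕP.*-mono-≤ k+1≤ k+1≤))
             (ℕP.m≤n+m (increment j) (steep j))
  where
  k+1≤ : suc (suc j) ℕ.≤ j ℕ.+ j
  k+1≤ = ℕP.+-mono-≤ 2≤j ℕP.≤-refl
  k+1≡ : suc (suc j) ≡ 1 ℕ.+ suc j ℕ.* 1
  k+1≡ = cong suc (sym (ℕP.*-identityʳ (suc j)))

module Star (k : ℕ) where

  -- The centre is the last vertex; two vertices are adjacent iff exactly one
  -- of them is the centre.
  centre : Fin (suc k)
  centre = fromℕ k

  isCentre : Fin (suc k) → Bool
  isCentre u = does (u ≟ centre)

  star : Graph (suc k)
  star = record
    { adj    = λ u v → isCentre u xor isCentre v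
    ; symm   = λ u v → xor-comm (isCentre u) (isCentre v)
    ; irrefl = λ v → xor-same (isCentre v)
    }

  isCentre-centre : isCentre centre ≡ true
  isCentre-centre = dec-true (centre ≟ centre) refl

  isCentre-below : ∀ u → toℕ u ℕ.< k → isCentre u ≡ false
  isCentre-below u u<k = dec-false (u ≟ centre) λ u≡c →
    ℕP.<-irrefl (trans (cong toℕ u≡c) (FinP.toℕ-fromℕ k)) u<k

  position≤k : ∀ (t : Fin (suc k)) → toℕ t ℕ.≤ k
  position≤k t = ℕ.s≤s⁻¹ (FinP.toℕ<n t)

  leaf-below : ∀ u → u ≢ centre → toℕ u ℕ.< k
  leaf-below u u≢c = ℕP.≤∧≢⇒< (position≤k u) λ e →
    u≢c (FinP.toℕ-injective (trans e (sym (FinP.toℕ-fromℕ k))))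

  adjacent-centre : ∀ u → u ≢ centre → adj star u centre ≡ true
  adjacent-centre u u≢c rewrite dec-false (u ≟ centre) u≢c | isCentre-centre = refl

  connected : Connected star
  connected u v with u ≟ centre | v ≟ centre
  ... | yes refl | yes refl = here
  ... | yes refl | no v≢c   = step here (trans (symm star centre v) (adjacent-centre v v≢c))
  ... | no u≢c   | yes refl = step here (adjacent-centre u u≢c)
  ... | no u≢c   | no v≢c   =
    step {v = centre} (step here (adjacent-centre u u≢c)) (trans (symm star centre v) (adjacent-centre v v≢c))

  leavesFirst : Fin (suc k) → Fin (suc k)
  leavesFirst i = i

  leavesFirst-perm : IsPerm leavesFirst
  leavesFirst-perm e = e

  -- Before position t only leaves have been placed, so a vertex has t
  -- earlier neighbours if it is the centre and none otherwise.
  nbrsBefore-leavesFirst : ∀ t u → t ℕ.≤ k →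
    nbrsBefore star leavesFirst t u ≡ (if isCentre u then t else 0)
  nbrsBefore-leavesFirst t u t≤k = trans
    (countBelow-cong t _ _ λ s s<t → earlier-leaf s (ℕP.<-≤-trans s<t t≤k))
    (countBelow-const t (isCentre u))
    where
    earlier-leaf : ∀ s → s ℕ.< k →
      atℕ (λ i → isCentre i xor isCentre u) false s ≡ isCentre u
    earlier-leaf s s<k
      rewrite atℕ-fromℕ< (λ i → isCentre i xor isCentre u) false s (ℕP.<-trans s<k (ℕP.n<1+n k))
            | isCentre-below (fromℕ< (ℕP.<-trans s<k (ℕP.n<1+n k)))
                (subst (ℕ._< k) (sym (FinP.toℕ-fromℕ< _)) s<k) = refl

  -- If f is least at 0, leaves-first is a greedy order: a leaf costs f 0,
  -- and when the centre is chosen every other vertex has been chosen already.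
  leavesFirst-greedy : ∀ (f : ℕ → ℚ) → (∀ i → f 0 ≤ f i) → IsGreedy star f leavesFirst
  leavesFirst-greedy f f0-least t u unchosen
    rewrite nbrsBefore-leavesFirst (toℕ t) t (position≤k t)
          | nbrsBefore-leavesFirst (toℕ t) u (position≤k t)
    with t ≟ centre | u ≟ centre
  ... | no _     | _        = f0-least _
  ... | yes _    | yes _    = ℚP.≤-refl
  ... | yes refl | no u≢c   = ⊥-elim (unchosen u u-earlier refl)
    where
    u-earlier : toℕ u ℕ.< toℕ centre
    u-earlier = subst (toℕ u ℕ.<_) (sym (FinP.toℕ-fromℕ k)) (leaf-below u u≢c)

  rank-centre-last : rank star leavesFirst centre ≡ k
  rank-centre-last
    rewrite nbrsBefore-leavesFirst (toℕ centre) centre (position≤k centre)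
          | isCentre-centre = FinP.toℕ-fromℕ k

  leavesFirst-cost-≥ : ∀ (h : ℕ → ℕ) → h k ℕ.≤ sumℕ (λ t → h (rank star leavesFirst t))
  leavesFirst-cost-≥ h = subst (ℕ._≤ sumℕ (λ t → h (rank star leavesFirst t)))
    (cong h rank-centre-last) (sumℕ-≥-term (λ t → h (rank star leavesFirst t)) centre)

  centreFirst : Fin (suc k) → Fin (suc k)
  centreFirst Fin.zero    = centre
  centreFirst (Fin.suc i) = inject₁ i

  centreFirst-perm : IsPerm centreFirst
  centreFirst-perm {Fin.zero}  {Fin.zero}  e = refl
  centreFirst-perm {Fin.zero}  {Fin.suc j} e = ⊥-elim (FinP.fromℕ≢inject₁ e)
  centreFirst-perm {Fin.suc i} {Fin.zero}  e = ⊥-elim (FinP.fromℕ≢inject₁ (sym e))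
  centreFirst-perm {Fin.suc i} {Fin.suc j} e = cong Fin.suc (FinP.inject₁-injective e)

  isCentre-inject₁ : ∀ (i : Fin k) → isCentre (inject₁ i) ≡ false
  isCentre-inject₁ i = isCentre-below (inject₁ i) (FinP.inject₁ℕ< i)

  rank-leaf-after-centre : ∀ (i : Fin k) → rank star centreFirst (Fin.suc i) ≡ 1
  rank-leaf-after-centre i = countBelow-only-first (toℕ i) _ centre-adjacent earlier-leaves
    where
    centre-adjacent : isCentre centre xor isCentre (inject₁ i) ≡ true
    centre-adjacent rewrite isCentre-centre | isCentre-inject₁ i = refl
    earlier-leaves : ∀ s → s ℕ.< toℕ i →
      atℕ (λ j → isCentre (inject₁ j) xor isCentre (inject₁ i)) false s ≡ false
    earlier-leaves s s<i
      rewrite atℕ-fromℕ< (λ j → isCentre (inject₁ j) xor isCentre (inject₁ i)) false s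
                (ℕP.<-trans s<i (FinP.toℕ<n i))
            | isCentre-inject₁ (fromℕ< (ℕP.<-trans s<i (FinP.toℕ<n i)))
            | isCentre-inject₁ i = refl

  centreFirst-cost : ∀ (h : ℕ → ℕ) →
    sumℕ (λ t → h (rank star centreFirst t)) ≡ h 0 ℕ.+ k ℕ.* h 1
  centreFirst-cost h = cong (h 0 ℕ.+_)
    (sumℕ-const _ (h 1) (λ i → cong h (rank-leaf-after-centre i)))

  minCost-≤ : ∀ (h : ℕ → ℕ) m → IsMinCost star (λ i → ℕtoℚ (h i)) m →
              m ≤ ℕtoℚ (h 0 ℕ.+ k ℕ.* h 1)
  minCost-≤ h m (_ , m≤all) = subst (m ≤_)
    (trans (cost-ℕ star h centreFirst) (cong ℕtoℚ (centreFirst-cost h)))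
    (m≤all centreFirst centreFirst-perm)

  greedy-ratio : 3 ℕ.≤ k → ∀ m → IsMinCost star steepℚ m →
    0ℚ < m × 1ℚ * ℕtoℚ (suc k) * m ≤ cost star steepℚ leavesFirst
  greedy-ratio 3≤k m min@((τ , _ , cost≡m) , _) =
    subst (0ℚ <_) cost≡m (cost-pos star steep steep-≥1 τ) , ratio
    where
    open ℚP.≤-Reasoning
    optimum : ℕ
    optimum = steep 0 ℕ.+ k ℕ.* steep 1
    ratio : 1ℚ * ℕtoℚ (suc k) * m ≤ cost star steepℚ leavesFirst
    ratio = begin
      1ℚ * ℕtoℚ (suc k) * m
        ≡⟨ cong (_* m) (ℚP.*-identityˡ (ℕtoℚ (suc k))) ⟩
      ℕtoℚ (suc k) * m
        ≤⟨ ℚP.*-monoˡ-≤-nonNeg (ℕtoℚ (suc k)) {{nonNegative (ℕtoℚ-mono-≤ {0} {suc k} ℕ.z≤n)}}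
             (minCost-≤ steep m min) ⟩
      ℕtoℚ (suc k) * ℕtoℚ optimum
        ≡⟨ sym (ℕtoℚ-* (suc k) optimum) ⟩
      ℕtoℚ (suc k ℕ.* optimum)
        ≤⟨ ℕtoℚ-mono-≤ (ℕP.≤-trans (steep-outgrows k 3≤k) (leavesFirst-cost-≥ steep)) ⟩
      ℕtoℚ (sumℕ (λ t → steep (rank star leavesFirst t)))
        ≡⟨ sym (cost-ℕ star steep leavesFirst) ⟩
      cost star steepℚ leavesFirst ∎

mainTheorem6 : Σ (ℕ → ℚ) λ f → NonNeg f × Convex f ×
    Σ ℚ λ c → 0ℚ < c ×
    ∀ (N : ℕ) → Σ ℕ λ n → Data.Nat._≤_ N n ×
    Σ (Graph n) λ G → Connected G ×
    Σ (Fin n → Fin n) λ σ → IsPerm σ × IsGreedy G f σ ×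
    (∀ (m : ℚ) → IsMinCost G f m → 0ℚ < m × c * ℕtoℚ n * m ≤ cost G f σ)
mainTheorem6 =
  steepℚ , steepℚ-nonNeg , steepℚ-convex , 1ℚ , ℕtoℚ-mono-< (ℕP.n<1+n 0) , λ N →
    let k = 3 ℕ.+ N
        open Star k
    in suc k , ℕP.m≤n+m N 4 , star , connected ,
       leavesFirst , leavesFirst-perm , leavesFirst-greedy steepℚ steepℚ-least-at-0 ,
       greedy-ratio (ℕP.m≤m+n 3 N)
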